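{- For each of the following sets $P$ of generalized patterns, $|S_n(P)|=2^{n-1}$ for every $n\ge1$: $\{1\text{ - }23,12\text{ - }3,2\text{ - }13,21\text{ - }3\}$, $\{31\text{ - }2,3\text{ - }12,13\text{ - }2,1\text{ - }32\}$, $\{2\text{ - }13,21\text{ - }3,13\text{ - }2,1\text{ - }32\}$, $\{2\text{ - }31,23\text{ - }1,1\text{ - }32,13\text{ - }2\}$.
   Context: $S_n$ is the set of permutations $\pi=\pi_1\pi_2\cdots\pi_n$ of $\{1,\dots,n\}$. For $abc$ a permutation of $123$, the generalized pattern $a\text{ - }bc$ is contained in $\pi$ if there are indices $i<j$ with $j+1\le n$ such that $\pi_i\pi_j\pi_{j+1}$ is order-isomorphic to $abc$; the generalized pattern $ab\text{ - }c$ is contained in $\pi$ if there are indices $i,k$ with $i+1<k\le n$ such that $\pi_i\pi_{i+1}\pi_k$ is order-isomorphic to $abc$. (Letters not separated by a dash must occur in adjacent positions; letters separated by a dash need not be adjacent.) $\pi$ avoids a pattern if it does not contain it. For a set $P$ of generalized patterns, $S_n(P)$ is the set of $\pi\in S_n$ avoiding every pattern in $P$. -}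

module Defs where

open import Data.Fin.Base using (Fin; toℕ) renaming (_<_ to _<ᶠ_)
open import Data.Fin.Permutation using (Permutation′; _⟨$⟩ʳ_)
open import Data.List.Base using (List; []; _∷_)
open import Data.List.Membership.Propositional using (_∈_)
open import Data.List.Relation.Unary.All as All using (All)
open import Data.Nat.Base using (ℕ; suc; _<_)
open import Data.Nat.Properties using (_≟_)
open import Data.List.Membership.DecPropositional _≟_ using (_∈?_)
open import Data.Product.Base using (Σ; ∃-syntax; _×_; proj₁)
open import Data.Vec.Base using (Vec; []; _∷_; lookup)
open import Function.Bundles using (Inverse; _⇔_)
open import Level using (0ℓ)
open import Relation.Binary.Bundles using (Setoid)
import Relation.Binary.Construct.On as On
open import Relation.Binary.PropositionalEquality using (_≡_; setoid; _→-setoid_)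
open import Relation.Nullary.Decidable.Core using (Dec; True)
open import Relation.Nullary.Negation.Core using (¬_)

-- A three-letter word in which each of 1, 2, 3 occurs is a permutation of 123.
Is123Perm : ℕ → ℕ → ℕ → Set
Is123Perm a b c = All (_∈ a ∷ b ∷ c ∷ []) (1 ∷ 2 ∷ 3 ∷ [])

is123Perm? : ∀ a b c → Dec (Is123Perm a b c)
is123Perm? a b c = All.all? (_∈? a ∷ b ∷ c ∷ []) (1 ∷ 2 ∷ 3 ∷ [])

-- ⟨ a - b ⌢ c ⟩ is the generalized pattern a-bc and ⟨ a ⌢ b - c ⟩ is ab-c:
-- letters joined by ⌢ must occur in adjacent positions.
data GenPattern : Set where
  ⟨_-_⌢_⟩ : (a b c : ℕ) {perm : True (is123Perm? a b c)} → GenPattern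
  ⟨_⌢_-_⟩ : (a b c : ℕ) {perm : True (is123Perm? a b c)} → GenPattern

OrderIsomorphic : ∀ {k} → Vec ℕ k → Vec ℕ k → Set
OrderIsomorphic u v = ∀ r s → lookup u r < lookup u s ⇔ lookup v r < lookup v s

-- Positions and values are counted from 0 rather than from 1, which affects
-- neither adjacency nor order-isomorphism.
module _ {n : ℕ} (π : Permutation′ n) where

  letter : Fin n → ℕ
  letter i = toℕ (π ⟨$⟩ʳ i)

  -- In both clauses the equation on toℕ says that two positions are consecutive.
  Contains : GenPattern → Set
  Contains ⟨ a - b ⌢ c ⟩ =
    ∃[ i ] ∃[ j ] ∃[ j′ ] i <ᶠ j × toℕ j′ ≡ suc (toℕ j) ×
      OrderIsomorphic (letter i ∷ letter j ∷ letter j′ ∷ []) (a ∷ b ∷ c ∷ [])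
  Contains ⟨ a ⌢ b - c ⟩ =
    ∃[ i ] ∃[ i′ ] ∃[ k ] toℕ i′ ≡ suc (toℕ i) × i′ <ᶠ k ×
      OrderIsomorphic (letter i ∷ letter i′ ∷ letter k ∷ []) (a ∷ b ∷ c ∷ [])

  Avoids : GenPattern → Set
  Avoids p = ¬ Contains p

-- Permutations are functions bundled with inverses and (without function
-- extensionality) proofs of avoidance need not be unique, so the elements of
-- S_n(P) are identified when they are pointwise equal as permutations.
S : ℕ → List GenPattern → Setoid 0ℓ 0ℓ
S n P = On.setoid {B = Σ (Permutation′ n) λ π → ∀ p → p ∈ P → Avoids π p}
                  (Fin n →-setoid Fin n) (λ σ → proj₁ σ ⟨$⟩ʳ_)

HasCardinality : Setoid 0ℓ 0ℓ → ℕ → Set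
HasCardinality A m = Inverse A (setoid (Fin m))

{-# OPTIONS --safe #-}
-- An occurrence of the underlying classical patterns, without adjacency, yields
-- one with adjacent letters: move along the word until a threshold value is
-- crossed.  Hence avoiding P amounts to a condition on all triples i < j < k of
-- positions: the third letter is not the largest; the third letter is not the
-- middle one; the letters are not ordered as 213 or 132; the second letter is
-- not the largest.  The second and fourth conditions are exchanged by passing
-- to the inverse permutation.  In the first three cases, deleting the last
-- letter leaves a smaller permutation of the same kind, and there are exactly
-- two letters that can be appended to that one: the smallest value and,
-- respectively, the second smallest, the largest, or the successor of the
-- preceding letter.  So the count doubles with every step.
module Submission where

open import Defs
open import Data.Fin.Base
  using (Fin; zero; suc; toℕ; fromℕ; punchIn; punchOut; _≤_; _<_)
open import Data.Fin.Patterns using (0F; 1F; 2F)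
open import Data.Fin.Permutation
  using (Permutation′; _⟨$⟩ʳ_; _⟨$⟩ˡ_; _≈_; id; flip; inverseʳ;
         insert; remove; insert-punchIn; insert-remove; remove-insert; punchIn-permute)
open import Data.Fin.Properties
  using (<-cmp; <-asym; <-irrefl; <-trans; ≤-refl; ≤-reflexive; <⇒≢;
         ≤∧≢⇒<; _<?_; _≤?_; _≟_; ≤fromℕ; punchInᵢ≢i; punchIn-injective;
         punchIn-cancel-≤; punchIn-mono-≤; punchIn-punchOut; *↔×)
open import Data.List.Base using (List; []; _∷_)
open import Data.List.Membership.Propositional using (_∈_)
open import Data.List.Relation.Unary.All using (All; []; _∷_) renaming (lookup to lookupAll)
open import Data.List.Relation.Unary.Any using (here; there)
open import Data.Nat.Base using (ℕ; zero; suc; _≥_; _∸_; _^_; z≤n; s≤s; z<s; s<s; s<s⁻¹)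
  renaming (_<_ to _<ⁿ_)
import Data.Nat.Properties as ℕ
open import Data.Product.Base using (Σ; ∃-syntax; _×_; _,_; proj₁; map)
open import Data.Product.Function.NonDependent.Setoid using (_×-inverse_)
open import Data.Product.Relation.Binary.Pointwise.NonDependent using (_×ₛ_; Pointwise-≡↔≡)
open import Data.Sum.Base as Sum using (_⊎_; inj₁; inj₂; [_,_]′)
open import Data.Vec.Base as Vec using (Vec; []; _∷_; lookup)
open import Data.Vec.Properties using (lookup-map)
open import Function.Base using (_∘_; case_of_)
open import Function.Bundles using (Inverse; Injection; Equivalence; mk⇔)
import Function.Consequences.Setoid as Consequences
open import Function.Construct.Composition using (inverse)
import Function.Construct.Identity as Identity
import Function.Construct.Symmetry as Symmetry
open import Function.Properties.Inverse using (↔⇒↣)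
open import Level using (0ℓ)
open import Relation.Binary.Bundles using (Setoid)
open import Relation.Binary.Core using (Rel)
open import Relation.Binary.Definitions using (tri<; tri≈; tri>)
import Relation.Binary.Construct.On as On
open import Relation.Binary.PropositionalEquality
  using (_≡_; _≢_; refl; sym; trans; cong; subst; subst₂; setoid; _→-setoid_)
open import Relation.Nullary.Decidable using (Dec; yes; no)
open import Relation.Nullary.Negation using (¬_; contradiction)
open import Relation.Unary using (Pred; Decidable)

private
  variable
    m n : ℕ

-- Conditions on triples of letters

TripleCondition : Set₁
TripleCondition = ∀ {A : Set} → Rel A 0ℓ → A → A → A → Set

-- f and g are words over possibly different alphabets, so that this covers both
-- order-isomorphic occurrences of a pattern and the relabelling of positions or
-- letters when a letter is deleted.
Monotone : TripleCondition → Set₁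
Monotone T = ∀ {I A B : Set} (R : Rel A 0ℓ) (R′ : Rel B 0ℓ) (f : I → A) (g : I → B) →
  (∀ {r s} → R (f r) (f s) → R′ (g r) (g s)) →
  ∀ {r s t} → T R (f r) (f s) (f t) → T R′ (g r) (g s) (g t)

-- For distinct letters the triple is ordered, in turn, as 123 or 213, as 132 or 312, as 213 or 132,
-- as 132 or 231.
LastLargest LastMedian 213or132 MiddleLargest : TripleCondition
LastLargest   _<_ x y z = x < z × y < z
LastMedian    _<_ x y z = (x < z × z < y) ⊎ (y < z × z < x)
213or132      _<_ x y z = (y < x × x < z) ⊎ (x < z × z < y)
MiddleLargest _<_ x y z = x < y × z < y

Free : TripleCondition → Permutation′ n → Set
Free T π = ∀ {i j k} → i < j → j < k → ¬ T _<_ (π ⟨$⟩ʳ i) (π ⟨$⟩ʳ j) (π ⟨$⟩ʳ k)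

FreePermutations : TripleCondition → ℕ → Setoid 0ℓ 0ℓ
FreePermutations T n =
  On.setoid {B = Σ (Permutation′ n) (Free T)} (Fin n →-setoid Fin n) (λ σ → proj₁ σ ⟨$⟩ʳ_)

strictInverse : ∀ (A B : Setoid 0ℓ 0ℓ) → let open Setoid renaming (_≈_ to Eq) in
  (to : Carrier A → Carrier B) (from : Carrier B → Carrier A) →
  (∀ {x y} → Eq A x y → Eq B (to x) (to y)) →
  (∀ {x y} → Eq B x y → Eq A (from x) (from y)) →
  (∀ y → Eq B (to (from y)) y) → (∀ x → Eq A (from (to x)) x) → Inverse A B
strictInverse A B to from to-cong from-cong to∘from from∘to = record
  { to        = to
  ; from      = from
  ; to-cong   = to-cong
  ; from-cong = from-cong
  ; inverse   = strictlyInverseˡ⇒inverseˡ to-cong to∘from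
              , strictlyInverseʳ⇒inverseʳ from-cong from∘to
  }
  where open Consequences A B

injective : ∀ (π : Permutation′ n) {i j} → π ⟨$⟩ʳ i ≡ π ⟨$⟩ʳ j → i ≡ j
injective π = Injection.injective (↔⇒↣ π)

≢∧≮⇒> : ∀ {i j : Fin n} → i ≢ j → ¬ i < j → j < i
≢∧≮⇒> {i = i} {j} i≢j i≮j with <-cmp i j
... | tri< i<j _   _   = contradiction i<j i≮j
... | tri≈ _   i≡j _   = contradiction i≡j i≢j
... | tri> _   _   j<i = j<i

-- Generalized patterns

CrossesBetween : Pred (Fin n) 0ℓ → Fin n → Fin n → Set
CrossesBetween U i j =
  ∃[ p ] ∃[ p′ ] i ≤ p × toℕ p′ ≡ suc (toℕ p) × p′ ≤ j × ¬ U p × U p′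

crossesBetween-suc : ∀ {U : Pred (Fin (suc n)) 0ℓ} {i j} →
                     CrossesBetween (U ∘ suc) i j → CrossesBetween U (suc i) (suc j)
crossesBetween-suc (p , p′ , i≤p , adj , p′≤j , ¬Up , Up′) =
  suc p , suc p′ , s≤s i≤p , cong suc adj , s≤s p′≤j , ¬Up , Up′

crossesBetween-zero : ∀ {U : Pred (Fin (suc n)) 0ℓ} {i j} →
                      CrossesBetween U i j → CrossesBetween U zero j
crossesBetween-zero (p , p′ , _ , rest) = p , p′ , z≤n , rest

-- A discrete intermediate value argument: the first position after `i` at which `U` holds serves as
-- `p′`.
crossing : ∀ {U : Pred (Fin n) 0ℓ} → Decidable U → ∀ {i j} → i < j → ¬ U i → U j →
           CrossesBetween U i j
crossing U? {zero} {suc zero} _ ¬Ui Uj = 0F , 1F , z≤n , refl , ℕ.≤-refl , ¬Ui , Uj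
crossing {U = U} U? {zero} {suc j@(suc _)} _ ¬Ui Uj = fromDec (U? 1F) λ ¬U1 →
    crossesBetween-zero (crossesBetween-suc {U = U} (crossing (U? ∘ suc) {0F} {j} z<s ¬U1 Uj))
  where
  fromDec : Dec (U 1F) → (¬ U 1F → CrossesBetween U zero (suc j)) → CrossesBetween U zero (suc j)
  fromDec (yes U1) _  = 0F , 1F , z≤n , refl , s≤s z≤n , ¬Ui , U1
  fromDec (no ¬U1) go = go ¬U1
crossing {U = U} U? {suc i} {suc j} i<j ¬Ui Uj =
  crossesBetween-suc {U = U} (crossing (U? ∘ suc) {i} {j} (s<s⁻¹ i<j) ¬Ui Uj)

module _ {x y z : ℕ} (x<y : x <ⁿ y) (y<z : y <ⁿ z) where

  private
    rank ranked : Fin 3 → ℕ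
    rank a = suc (toℕ a)
    ranked = lookup (x ∷ y ∷ z ∷ [])

  ranked-mono : ∀ {a b} → a < b → ranked a <ⁿ ranked b
  ranked-mono {0F} {1F} _ = x<y
  ranked-mono {0F} {2F} _ = ℕ.<-trans x<y y<z
  ranked-mono {1F} {2F} _ = y<z
  ranked-mono {1F} {1F} (s≤s ())
  ranked-mono {2F} {1F} (s≤s ())
  ranked-mono {2F} {2F} (s≤s (s≤s ()))

  ranked-cancel : ∀ {a b} → ranked a <ⁿ ranked b → a < b
  ranked-cancel {a} {b} lt with <-cmp a b
  ... | tri< a<b _    _   = a<b
  ... | tri≈ _   refl _   = contradiction lt (ℕ.<-irrefl refl)
  ... | tri> _   _    b<a = contradiction lt (ℕ.<-asym (ranked-mono b<a))

  -- Both words are images of `w` under strictly increasing maps on `Fin 3`. In use, `w` lists the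
  -- letters of the pattern lowered by one, and `x`, `y`, `z` are the letters of the occurrence in
  -- increasing order.
  orderIsomorphic : (w : Vec (Fin 3) m) → OrderIsomorphic (Vec.map ranked w) (Vec.map rank w)
  orderIsomorphic w r s
    rewrite lookup-map r ranked w | lookup-map s ranked w
          | lookup-map r rank w | lookup-map s rank w
    = mk⇔ (s<s ∘ ranked-cancel) (ranked-mono ∘ s<s⁻¹)

Satisfies : TripleCondition → GenPattern → Set
Satisfies T ⟨ a - b ⌢ c ⟩ = T _<ⁿ_ a b c
Satisfies T ⟨ a ⌢ b - c ⟩ = T _<ⁿ_ a b c

module _ (π : Permutation′ n) where

  occurrence-satisfies :
    ∀ (T : TripleCondition) → Monotone T → ∀ {a b c i j k} →
    OrderIsomorphic (letter π i ∷ letter π j ∷ letter π k ∷ []) (a ∷ b ∷ c ∷ []) →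
    T _<ⁿ_ a b c → T _<_ (π ⟨$⟩ʳ i) (π ⟨$⟩ʳ j) (π ⟨$⟩ʳ k)
  occurrence-satisfies T mono {a} {b} {c} {i} {j} {k} iso t =
    -- The inner `mono` passes from the pattern to the letters as natural numbers; the outer one
    -- returns to `Fin n`, whose order is by definition that of `toℕ`.
    mono _<ⁿ_ _<_ toℕ (λ x → x) (λ lt → lt)
      (mono _<ⁿ_ _<ⁿ_ (lookup (a ∷ b ∷ c ∷ [])) (lookup (letter π i ∷ letter π j ∷ letter π k ∷ []))
        (λ {r} {s} → Equivalence.from (iso r s)) {0F} {1F} {2F} t)

  free⇒avoids : ∀ (T : TripleCondition) → Monotone T → Free T π →
                ∀ p → Satisfies T p → Avoids π p
  free⇒avoids T mono free ⟨ a - b ⌢ c ⟩ t (i , j , j′ , i<j , adj , iso) =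
    free i<j (ℕ.≤-reflexive (sym adj)) (occurrence-satisfies T mono iso t)
  free⇒avoids T mono free ⟨ a ⌢ b - c ⟩ t (i , i′ , k , adj , i′<k , iso) =
    free (ℕ.≤-reflexive (sym adj)) i′<k (occurrence-satisfies T mono iso t)

  private
    πʳ : Fin n → Fin n
    πʳ = π ⟨$⟩ʳ_

  π-distinct : ∀ {i j} → i < j → πʳ i ≢ πʳ j
  π-distinct i<j eq = <-irrefl (injective π eq) i<j

  module _ {i j k : Fin n} (i<j : i < j) (j<k : j < k) where

    -- Here and in the next three lemmas the letter standing alone beside the dash is the 2 of the
    -- pattern. It serves as the threshold, and a crossing between the other two positions supplies
    -- the adjacent pair. At `p` the crossing gives only a negated inequality, which distinctness of
    -- letters turns into a strict one.
    avoids-13-2 : Avoids π ⟨ 1 ⌢ 3 - 2 ⟩ → ¬ (πʳ i < πʳ k × πʳ k < πʳ j)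
    avoids-13-2 avoids (x<z , z<y) =
      let p , p′ , _ , adj , p′≤j , p≯k , k<p′ =
            crossing (λ q → πʳ k <? πʳ q) i<j (<-asym x<z) z<y
          p′<k = ℕ.≤-<-trans p′≤j j<k
          p<k = <-trans (ℕ.≤-reflexive (sym adj)) p′<k
      in avoids (p , p′ , k , adj , p′<k ,
           orderIsomorphic (≢∧≮⇒> (π-distinct p<k ∘ sym) p≯k) k<p′ (0F ∷ 2F ∷ 1F ∷ []))

    avoids-31-2 : Avoids π ⟨ 3 ⌢ 1 - 2 ⟩ → ¬ (πʳ j < πʳ k × πʳ k < πʳ i)
    avoids-31-2 avoids (y<z , z<x) =
      let p , p′ , _ , adj , p′≤j , p≮k , p′<k′ =
            crossing (λ q → πʳ q <? πʳ k) i<j (<-asym z<x) y<z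
          p′<k = ℕ.≤-<-trans p′≤j j<k
          p<k = <-trans (ℕ.≤-reflexive (sym adj)) p′<k
      in avoids (p , p′ , k , adj , p′<k ,
           orderIsomorphic p′<k′ (≢∧≮⇒> (π-distinct p<k) p≮k) (2F ∷ 0F ∷ 1F ∷ []))

    avoids-2-13 : Avoids π ⟨ 2 - 1 ⌢ 3 ⟩ → ¬ (πʳ j < πʳ i × πʳ i < πʳ k)
    avoids-2-13 avoids (y<x , x<z) =
      let p , p′ , j≤p , adj , _ , p≯i , i<p′ =
            crossing (λ q → πʳ i <? πʳ q) j<k (<-asym y<x) x<z
          i<p = ℕ.<-≤-trans i<j j≤p
      in avoids (i , p , p′ , i<p , adj ,
           orderIsomorphic (≢∧≮⇒> (π-distinct i<p) p≯i) i<p′ (1F ∷ 0F ∷ 2F ∷ []))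

    avoids-2-31 : Avoids π ⟨ 2 - 3 ⌢ 1 ⟩ → ¬ (πʳ k < πʳ i × πʳ i < πʳ j)
    avoids-2-31 avoids (z<x , x<y) =
      let p , p′ , j≤p , adj , _ , p≮i , p′<i =
            crossing (λ q → πʳ q <? πʳ i) j<k (<-asym x<y) z<x
          i<p = ℕ.<-≤-trans i<j j≤p
      in avoids (i , p , p′ , i<p , adj ,
           orderIsomorphic p′<i (≢∧≮⇒> (π-distinct i<p ∘ sym) p≮i) (1F ∷ 2F ∷ 0F ∷ []))

    -- The threshold is the letter at `k`, taken weakly so that `k` itself is past it. The crossing
    -- makes the letter at `p′` exceed those at `i` and `p`; the order of these two decides between
    -- 1-23 and 2-13.
    avoids-1-23∧2-13 : Avoids π ⟨ 1 - 2 ⌢ 3 ⟩ → Avoids π ⟨ 2 - 1 ⌢ 3 ⟩ →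
                       ¬ (πʳ i < πʳ k × πʳ j < πʳ k)
    avoids-1-23∧2-13 avoids₁ avoids₂ (x<z , y<z) =
      let p , p′ , j≤p , adj , _ , p≱k , k≤p′ =
            crossing (λ q → πʳ k ≤? πʳ q) j<k (ℕ.<⇒≱ y<z) ℕ.≤-refl
          i<p = ℕ.<-≤-trans i<j j≤p
      in case <-cmp (πʳ i) (πʳ p) of λ where
           (tri< lt _ _) → avoids₁ (i , p , p′ , i<p , adj ,
             orderIsomorphic lt (ℕ.<-≤-trans (ℕ.≰⇒> p≱k) k≤p′) (0F ∷ 1F ∷ 2F ∷ []))
           (tri≈ _ eq _) → π-distinct i<p eq
           (tri> _ _ gt) → avoids₂ (i , p , p′ , i<p , adj ,
             orderIsomorphic gt (ℕ.<-≤-trans x<z k≤p′) (1F ∷ 0F ∷ 2F ∷ []))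

-- Both setoids compare only the underlying permutations, so two implications between the conditions
-- suffice and the maps leave the permutation unchanged.
S↔Free : ∀ {P} (T : TripleCondition) → Monotone T → All (Satisfies T) P →
         (∀ {n} (π : Permutation′ n) → (∀ p → p ∈ P → Avoids π p) → Free T π) →
         Inverse (S n P) (FreePermutations T n)
S↔Free {P = P} T mono sat avoids⇒free = strictInverse (S _ P) (FreePermutations T _)
  (map (λ π → π) (λ {π} → avoids⇒free π))
  (map (λ π → π) (λ {π} free p p∈P → free⇒avoids π T mono free p (lookupAll sat p∈P)))
  (λ eq → eq) (λ eq → eq) (λ _ _ → refl) (λ _ _ → refl)

-- Deleting the last letter

punchIn-mono-< : ∀ (i : Fin (suc n)) {j k} → j < k → punchIn i j < punchIn i k
punchIn-mono-< i j<k = ℕ.≰⇒> (ℕ.<⇒≱ j<k ∘ punchIn-cancel-≤ i _ _)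

punchIn-cancel-< : ∀ (i : Fin (suc n)) {j k} → punchIn i j < punchIn i k → j < k
punchIn-cancel-< i ij<ik = ℕ.≰⇒> (ℕ.<⇒≱ ij<ik ∘ punchIn-mono-≤ i _ _)

-- Making room for a new letter `suc v` fixes the letters up to `v` and raises the others by one.
-- With the next three lemmas, this turns comparisons with the new letter into comparisons with `v`.
punchIn-below : ∀ {v x : Fin n} → x ≤ v → punchIn (suc v) x < suc v
punchIn-below {v = v}     {zero}  _         = z<s
punchIn-below {v = suc v} {suc x} (s≤s x≤v) = s<s (punchIn-below x≤v)

punchIn-above : ∀ {v x : Fin n} → v < x → suc v < punchIn (suc v) x
punchIn-above {v = zero}  {suc x} _         = s<s z<s
punchIn-above {v = suc v} {suc x} (s≤s v<x) = s<s (punchIn-above v<x)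

punchIn-below⁻¹ : ∀ {v x : Fin n} → punchIn (suc v) x < suc v → x ≤ v
punchIn-below⁻¹ {v = v} lt = ℕ.≮⇒≥ (λ v<x → <-asym lt (punchIn-above {v = v} v<x))

punchIn-above⁻¹ : ∀ {v x : Fin n} → suc v < punchIn (suc v) x → v < x
punchIn-above⁻¹ {v = v} lt = ℕ.≰⇒> (λ x≤v → <-asym lt (punchIn-below {v = v} x≤v))

data PunchedIn (i : Fin (suc n)) : Fin (suc n) → Set where
  itself : PunchedIn i i
  other  : ∀ k → PunchedIn i (punchIn i k)

punchedIn : ∀ (i j : Fin (suc n)) → PunchedIn i j
punchedIn i j with i ≟ j
... | yes refl = itself
... | no  i≢j  = subst (PunchedIn i) (punchIn-punchOut i≢j) (other (punchOut i≢j))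

remove-cong : ∀ i {π ρ : Permutation′ (suc n)} → π ≈ ρ → remove i π ≈ remove i ρ
remove-cong i {π} {ρ} π≈ρ k = punchIn-injective (π ⟨$⟩ʳ i) _ _ (trans
  (sym (punchIn-permute π i k))
  (trans (π≈ρ (punchIn i k))
    (trans (punchIn-permute ρ i k) (cong (λ v → punchIn v (remove i ρ ⟨$⟩ʳ k)) (sym (π≈ρ i))))))

insert-self : ∀ i j (π : Permutation′ n) → insert i j π ⟨$⟩ʳ i ≡ j
insert-self i j π with i ≟ i
... | yes _   = refl
... | no  i≢i = contradiction refl i≢i

insert-cong : ∀ i {j j′} {π ρ : Permutation′ n} → j ≡ j′ → π ≈ ρ → insert i j π ≈ insert i j′ ρ
insert-cong i {j} {π = π} {ρ} refl π≈ρ k with punchedIn i k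
... | itself  = trans (insert-self i j π) (sym (insert-self i j ρ))
... | other l = trans (insert-punchIn i j π l)
                  (trans (cong (punchIn j) (π≈ρ l)) (sym (insert-punchIn i j ρ l)))

last : Fin (suc n)
last = fromℕ _

≢last⇒< : ∀ {i : Fin (suc n)} → i ≢ last → i < last
≢last⇒< i≢last = ≤∧≢⇒< (≤fromℕ _) i≢last

punchIn-last< : ∀ (i : Fin n) → punchIn last i < last
punchIn-last< i = ≢last⇒< (punchInᵢ≢i last i)

-- v can be appended to σ, whose letters ≥ v are shifted to make room for it,
-- without creating a forbidden triple ending in v.
Appendable : TripleCondition → Permutation′ n → Fin (suc n) → Set
Appendable T σ v =
  ∀ {i j} → i < j → ¬ T _<_ (punchIn v (σ ⟨$⟩ʳ i)) (punchIn v (σ ⟨$⟩ʳ j)) v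

module _ (T : TripleCondition) (mono : Monotone T) where

  Free-cong : ∀ {π ρ : Permutation′ n} → π ≈ ρ → Free T π → Free T ρ
  Free-cong {π = π} {ρ} π≈ρ free i<j j<k t = free i<j j<k
    (mono _<_ _<_ (ρ ⟨$⟩ʳ_) (π ⟨$⟩ʳ_)
          (λ {r} {s} → subst₂ _<_ (sym (π≈ρ r)) (sym (π≈ρ s))) t)

  Appendable-cong : ∀ {σ τ : Permutation′ n} {v} → σ ≈ τ →
                    Appendable T σ v → Appendable T τ v
  Appendable-cong {v = v} σ≈τ app {i} {j} i<j t = app i<j
    (subst₂ (λ x y → T _<_ (punchIn v x) (punchIn v y) v) (sym (σ≈τ i)) (sym (σ≈τ j)) t)

  module _ (π : Permutation′ (suc n)) where

    private
      πʳ : Fin (suc n) → Fin (suc n)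
      πʳ = π ⟨$⟩ʳ_
      σ : Permutation′ n
      σ = remove last π

    free-remove : Free T π → Free T σ
    free-remove free i<j j<k t =
      free (punchIn-mono-< last i<j) (punchIn-mono-< last j<k)
        (mono _<_ _<_ (σ ⟨$⟩ʳ_) (πʳ ∘ punchIn last)
              (λ {r} {s} → subst₂ _<_ (sym (punchIn-permute π last r)) (sym (punchIn-permute π last s))
                             ∘ punchIn-mono-< (πʳ last)) t)

    free⇒appendable : Free T π → Appendable T σ (πʳ last)
    free⇒appendable free {i} {j} i<j t = free (punchIn-mono-< last i<j) (punchIn-last< j)
      (subst₂ (λ x y → T _<_ x y (πʳ last))
              (sym (punchIn-permute π last i)) (sym (punchIn-permute π last j)) t)

    -- Of three increasing positions only the third can be `last`. If it is, appendability excludes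
    -- the triple; if not, the triple already occurs in `σ`.
    appendable⇒free : Free T σ → Appendable T σ (πʳ last) → Free T π
    appendable⇒free free app {i} {j} {k} i<j j<k t
      with punchedIn last i | punchedIn last j | punchedIn last k
    ... | itself  | _       | _       = ℕ.<⇒≱ i<j (≤fromℕ j)
    ... | other _ | itself  | _       = ℕ.<⇒≱ j<k (≤fromℕ k)
    ... | other a | other b | itself  = app (punchIn-cancel-< last i<j)
      (subst₂ (λ x y → T _<_ x y (πʳ last))
              (punchIn-permute π last a) (punchIn-permute π last b) t)
    ... | other a | other b | other c = free (punchIn-cancel-< last i<j) (punchIn-cancel-< last j<k)
      (mono _<_ _<_ (πʳ ∘ punchIn last) (σ ⟨$⟩ʳ_)
            (λ {r} {s} → punchIn-cancel-< (πʳ last)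
                           ∘ subst₂ _<_ (punchIn-permute π last r) (punchIn-permute π last s))
            {a} {b} {c} t)

-- Counting by the appended letter

record AppendRule (T : TripleCondition) : Set₁ where
  field
    mono             : Monotone T
    zero-appendable  : ∀ {x y : Fin (suc n)} → ¬ T _<_ x y zero
    -- Stored one below the letter it stands for, so that `suc (alternative σ)` differs from `zero`
    -- by construction. Lengths start at 1 because only one letter can be appended to the empty
    -- permutation.
    alternative      : Permutation′ (suc n) → Fin (suc n)
    alternative-cong : ∀ {σ τ : Permutation′ (suc n)} → σ ≈ τ → alternative σ ≡ alternative τ
    appendable       : ∀ {σ : Permutation′ (suc n)} → Free T σ →
                       Appendable T σ (suc (alternative σ))
    unique           : ∀ {σ : Permutation′ (suc n)} {v} → Free T σ →
                       Appendable T σ (suc v) → v ≡ alternative σ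

module Counting {T : TripleCondition} (rule : AppendRule T) where
  open AppendRule rule

  choice : Fin (suc n) → Fin 2
  choice zero    = 0F
  choice (suc _) = 1F

  letterFor : Fin 2 → Permutation′ (suc n) → Fin (suc (suc n))
  letterFor 0F      _ = zero
  letterFor (suc _) σ = suc (alternative σ)

  letterFor-cong : ∀ b {σ τ : Permutation′ (suc n)} → σ ≈ τ → letterFor b σ ≡ letterFor b τ
  letterFor-cong 0F      _   = refl
  letterFor-cong (suc _) σ≈τ = cong suc (alternative-cong σ≈τ)

  letterFor-appendable : ∀ b {σ : Permutation′ (suc n)} → Free T σ → Appendable T σ (letterFor b σ)
  letterFor-appendable 0F      _    _ = zero-appendable
  letterFor-appendable (suc _) free   = appendable free

  choice-letterFor : ∀ b (σ : Permutation′ (suc n)) → choice (letterFor b σ) ≡ b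
  choice-letterFor 0F _ = refl
  choice-letterFor 1F _ = refl

  letterFor-choice : ∀ {σ : Permutation′ (suc n)} v → Free T σ → Appendable T σ v →
                     letterFor (choice v) σ ≡ v
  letterFor-choice zero    _    _   = refl
  letterFor-choice (suc v) free app = cong suc (sym (unique free app))

  append : Fin 2 → Permutation′ (suc n) → Permutation′ (suc (suc n))
  append b σ = insert last (letterFor b σ) σ

  append-free : ∀ b {σ : Permutation′ (suc n)} → Free T σ → Free T (append b σ)
  append-free b {σ} free =
    -- Deleting the appended letter gives back `σ` only up to pointwise equality, so freeness and
    -- appendability are both transported along `σ≈τ`.
    appendable⇒free T mono (append b σ)
      (Free-cong T mono {π = σ} {τ} σ≈τ free)
      (subst (Appendable T τ) (sym (insert-self last (letterFor b σ) σ))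
        (Appendable-cong T mono {σ = σ} {τ} σ≈τ (letterFor-appendable b free)))
    where
    τ : Permutation′ (suc _)
    τ = remove last (append b σ)
    σ≈τ : σ ≈ τ
    σ≈τ k = sym (remove-insert last (letterFor b σ) σ k)

  -- The bit records whether the last letter is `zero`. By `unique`, the bit and the remaining
  -- permutation determine that letter.
  doubling : ∀ n → Inverse (FreePermutations T (suc (suc n)))
                           (setoid (Fin 2) ×ₛ FreePermutations T (suc n))
  doubling n = strictInverse (FreePermutations T (suc (suc n)))
                             (setoid (Fin 2) ×ₛ FreePermutations T (suc n))
    (λ (π , free) → choice (π ⟨$⟩ʳ last) , remove last π , free-remove T mono π free)
    (λ (b , σ , free) → append b σ , append-free b free)
    (λ {(π , _)} {(ρ , _)} π≈ρ → cong choice (π≈ρ last) , remove-cong last {π} {ρ} π≈ρ)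
    (λ {(b , σ , _)} {(_ , τ , _)} → λ where
      (refl , σ≈τ) → insert-cong last {π = σ} {τ} (letterFor-cong b {σ} {τ} σ≈τ) σ≈τ)
    (λ (b , σ , _) →
      trans (cong choice (insert-self last (letterFor b σ) σ)) (choice-letterFor b σ) ,
      remove-insert last (letterFor b σ) σ)
    (λ (π , free) k → trans
      (insert-cong last {π = remove last π} {remove last π}
        (letterFor-choice (π ⟨$⟩ʳ last) (free-remove T mono π free) (free⇒appendable T mono π free))
        (λ _ → refl) k)
      (insert-remove last π k))

  cardinality : ∀ n → HasCardinality (FreePermutations T (suc n)) (2 ^ n)
  cardinality zero = strictInverse (FreePermutations T 1) (setoid (Fin 1))
    (λ _ → 0F)
    (λ _ → id , λ { {0F} {0F} () })
    (λ _ → refl)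
    (λ _ _ → refl)
    (λ { 0F → refl })
    (λ (π , _) i → Fin1-unique i (π ⟨$⟩ʳ i))
    where
    Fin1-unique : ∀ (i j : Fin 1) → i ≡ j
    Fin1-unique 0F 0F = refl
  cardinality (suc n) =
    -- `2 ^ suc n` unfolds to `2 * 2 ^ n`, so the reverse of `*↔×` merges the bit with the index
    -- from the induction hypothesis.
    inverse (doubling n)
      (inverse (Identity.inverse (setoid (Fin 2)) ×-inverse cardinality n)
        (inverse Pointwise-≡↔≡ (Symmetry.inverse *↔×)))

-- The three append rules

module _ (σ : Permutation′ n) where

  -- Lets a forbidden triple be built from two chosen values whose order in the word is unknown.
  values-ordered : ∀ {u v} → u ≢ v →
    (σ ⟨$⟩ˡ u) < (σ ⟨$⟩ˡ v) ⊎ (σ ⟨$⟩ˡ v) < (σ ⟨$⟩ˡ u)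
  values-ordered {u} {v} u≢v with <-cmp (σ ⟨$⟩ˡ u) (σ ⟨$⟩ˡ v)
  ... | tri< lt _  _  = inj₁ lt
  ... | tri≈ _  eq _  =
    contradiction (trans (sym (inverseʳ σ)) (trans (cong (σ ⟨$⟩ʳ_) eq) (inverseʳ σ))) u≢v
  ... | tri> _  _  gt = inj₂ gt

lastLargestRule : AppendRule LastLargest
lastLargestRule = record
  { mono             = λ _ _ _ _ h → map h h
  ; zero-appendable  = λ ()
  ; alternative      = λ _ → zero
  ; alternative-cong = λ _ → refl
  -- Only the old letter 0 lies below the new letter 1, so the two letters would coincide.
  ; appendable       = λ {_} {σ} _ i<j (x<1 , y<1) →
      π-distinct σ i<j (trans (≤0⇒≡0 (punchIn-below⁻¹ {v = 0F} x<1))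
                              (sym (≤0⇒≡0 (punchIn-below⁻¹ {v = 0F} y<1))))
  ; unique           = λ {_} {σ} _ → unique σ
  }
  where
  ≤0⇒≡0 : ∀ {x : Fin (suc n)} → x ≤ zero {n} → x ≡ zero
  ≤0⇒≡0 {x = zero} _ = refl

  unique : ∀ (σ : Permutation′ (suc n)) {v} → Appendable LastLargest σ (suc v) → v ≡ zero
  unique σ {zero}  app = refl
  unique σ {suc v} app =
    -- The old letters `zero` and `suc v` both lie below the new letter `suc (suc v)`, and their
    -- order does not matter.
    contradiction (values-ordered σ {zero} {suc v} λ ())
      [ (λ lt → app lt (low z≤n , low ≤v)) , (λ gt → app gt (low ≤v , low z≤n)) ]′
    where
    ≤v : suc v ≤ suc v
    ≤v = ≤-refl {x = suc v}
    low : ∀ {u} → u ≤ suc v → punchIn (suc (suc v)) (σ ⟨$⟩ʳ (σ ⟨$⟩ˡ u)) < suc (suc v)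
    low u≤v = punchIn-below (subst (_≤ suc v) (sym (inverseʳ σ)) u≤v)

lastMedianRule : AppendRule LastMedian
lastMedianRule = record
  { mono             = λ _ _ _ _ h → Sum.map (map h h) (map h h)
  ; zero-appendable  = λ { (inj₁ (() , _)) ; (inj₂ (() , _)) }
  ; alternative      = λ _ → last
  ; alternative-cong = λ _ → refl
  ; appendable       = λ where
      _ _ (inj₁ (_ , top<y)) → ℕ.<⇒≱ (punchIn-above⁻¹ {v = last} top<y) (≤fromℕ _)
      _ _ (inj₂ (_ , top<x)) → ℕ.<⇒≱ (punchIn-above⁻¹ {v = last} top<x) (≤fromℕ _)
  ; unique           = λ {_} {σ} _ → unique σ
  }
  where
  unique : ∀ (σ : Permutation′ (suc n)) {v} → Appendable LastMedian σ (suc v) → v ≡ last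
  unique σ {v} app with v ≟ last
  ... | yes v≡last = v≡last
  ... | no  v≢last =
    -- The old letter `v` lies just below the new letter and the old maximum above it; either order
    -- puts the new letter in the middle.
    contradiction (values-ordered σ {v} {last} v≢last)
      [ (λ lt → app lt (inj₁ (low , high))) , (λ gt → app gt (inj₂ (low , high))) ]′
    where
    low : punchIn (suc v) (σ ⟨$⟩ʳ (σ ⟨$⟩ˡ v)) < suc v
    low = punchIn-below (≤-reflexive (inverseʳ σ))
    high : suc v < punchIn (suc v) (σ ⟨$⟩ʳ (σ ⟨$⟩ˡ last))
    high = punchIn-above (subst (v <_) (sym (inverseʳ σ)) (≢last⇒< v≢last))

213or132Rule : AppendRule 213or132
213or132Rule = record
  { mono             = λ _ _ _ _ h → Sum.map (map h h) (map h h)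
  ; zero-appendable  = λ { (inj₁ (_ , ())) ; (inj₂ (() , _)) }
  ; alternative      = _⟨$⟩ʳ last
  ; alternative-cong = λ σ≈τ → σ≈τ last
  ; appendable       = λ {_} {σ} → appendable σ
  ; unique           = λ {_} {σ} _ → unique σ
  }
  where
  -- The new letter compares with earlier letters as the old last letter does, so a forbidden triple
  -- with `j` before `last` already occurs in `σ`. If `j` is `last`, its letter is immediately below
  -- the new one, with nothing in between as 213 would need, and not above it as 132 would need.
  appendable : ∀ (σ : Permutation′ (suc n)) → Free 213or132 σ →
               Appendable 213or132 σ (suc (σ ⟨$⟩ʳ last))
  appendable σ free {i} {j} i<j t with j ≟ last
  ... | no j≢last = free i<j (≢last⇒< j≢last) (Sum.map
      (λ (y<x , x<z) → punchIn-cancel-< (suc l) y<x , strict x<z)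
      (λ (x<z , z<y) → strict x<z , punchIn-above⁻¹ {v = l} z<y) t)
    where
    l = σ ⟨$⟩ʳ last
    strict : punchIn (suc l) (σ ⟨$⟩ʳ i) < suc l → (σ ⟨$⟩ʳ i) < l
    strict lt = ≤∧≢⇒< (punchIn-below⁻¹ {v = l} lt) (π-distinct σ (ℕ.<-≤-trans i<j (≤fromℕ j)))
  appendable σ free {i} i<j (inj₁ (y<x , x<z)) | yes refl =
    ℕ.<⇒≱ (punchIn-cancel-< (suc (σ ⟨$⟩ʳ last)) y<x) (punchIn-below⁻¹ {v = σ ⟨$⟩ʳ last} x<z)
  appendable σ free {i} i<j (inj₂ (_ , z<y))   | yes refl =
    <-irrefl refl (punchIn-above⁻¹ {v = σ ⟨$⟩ʳ last} z<y)

  -- If `v` is not the last letter of `σ`, then `v`, that last letter and the new letter `suc v`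
  -- occur in this order. They form 132 when the last letter exceeds `v`, and 213 when it is
  -- smaller.
  unique : ∀ (σ : Permutation′ (suc n)) {v} → Appendable 213or132 σ (suc v) → v ≡ σ ⟨$⟩ʳ last
  unique σ {v} app = case <-cmp v (σ ⟨$⟩ʳ last) of λ where
      (tri< v<l v≢l _) → contradiction (inj₂ (low , punchIn-above v<l)) (app (before-last v≢l))
      (tri≈ _ v≡l _)   → v≡l
      (tri> _ v≢l l<v) → contradiction
        (inj₁ (punchIn-mono-< (suc v) (subst ((σ ⟨$⟩ʳ last) <_) (sym (inverseʳ σ)) l<v) , low))
        (app (before-last v≢l))
    where
    before-last : v ≢ σ ⟨$⟩ʳ last → (σ ⟨$⟩ˡ v) < last
    before-last v≢l = ≢last⇒< λ eq → v≢l (trans (sym (inverseʳ σ)) (cong (σ ⟨$⟩ʳ_) eq))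
    low : punchIn (suc v) (σ ⟨$⟩ʳ (σ ⟨$⟩ˡ v)) < suc v
    low = punchIn-below (≤-reflexive (inverseʳ σ))

-- Passing to the inverse permutation

values-< : ∀ (π : Permutation′ n) {u v} → u < v → (π ⟨$⟩ʳ (π ⟨$⟩ˡ u)) < (π ⟨$⟩ʳ (π ⟨$⟩ˡ v))
values-< π = subst₂ _<_ (sym (inverseʳ π)) (sym (inverseʳ π))

flip-cong : ∀ {π ρ : Permutation′ n} → π ≈ ρ → flip π ≈ flip ρ
flip-cong {π = π} {ρ} π≈ρ k =
  injective ρ (trans (sym (π≈ρ _)) (trans (inverseʳ π) (sym (inverseʳ ρ))))

-- Inversion exchanges positions with values; it fixes 132 and turns 231 into 312. The converse
-- below splits on the order of the outer letters, which `MiddleLargest` leaves open.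
flip-lastMedian : ∀ (π : Permutation′ n) → Free MiddleLargest π → Free LastMedian (flip π)
flip-lastMedian π free {a} {b} {c} a<b b<c = λ where
    (inj₁ (a′<c′ , c′<b′)) → free a′<c′ c′<b′ (values-< π (<-trans a<b b<c) , values-< π b<c)
    (inj₂ (b′<c′ , c′<a′)) → free b′<c′ c′<a′ (values-< π b<c , values-< π (<-trans a<b b<c))

flip-middleLargest : ∀ (π : Permutation′ n) → Free LastMedian π → Free MiddleLargest (flip π)
flip-middleLargest π free {i} {j} {k} i<j j<k (x<y , z<y)
  with values-ordered π (<⇒≢ (<-trans i<j j<k))
... | inj₁ x<z = free x<z z<y (inj₁ (values-< π i<j , values-< π j<k))
... | inj₂ z<x = free z<x x<y (inj₂ (values-< π i<j , values-< π j<k))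

middleLargest↔lastMedian : Inverse (FreePermutations MiddleLargest n) (FreePermutations LastMedian n)
middleLargest↔lastMedian = strictInverse
  (FreePermutations MiddleLargest _) (FreePermutations LastMedian _)
  (map flip (λ {π} → flip-lastMedian π))
  (map flip (λ {π} → flip-middleLargest π))
  (λ {(π , _)} {(ρ , _)} → flip-cong {π = π} {ρ})
  (λ {(π , _)} {(ρ , _)} → flip-cong {π = π} {ρ})
  (λ _ _ → refl)
  (λ _ _ → refl)

-- The four pattern sets

private
  1<2 : 1 <ⁿ 2
  1<2 = s<s z<s

  2<3 : 2 <ⁿ 3
  2<3 = s<s 1<2

  1<3 : 1 <ⁿ 3
  1<3 = s<s z<s

mainTheorem3 : All (λ (P : List GenPattern) → (n : ℕ) → n ≥ 1 → HasCardinality (S n P) (2 ^ (n ∸ 1)))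
    ( (⟨ 1 - 2 ⌢ 3 ⟩ ∷ ⟨ 1 ⌢ 2 - 3 ⟩ ∷ ⟨ 2 - 1 ⌢ 3 ⟩ ∷ ⟨ 2 ⌢ 1 - 3 ⟩ ∷ [])
    ∷ (⟨ 3 ⌢ 1 - 2 ⟩ ∷ ⟨ 3 - 1 ⌢ 2 ⟩ ∷ ⟨ 1 ⌢ 3 - 2 ⟩ ∷ ⟨ 1 - 3 ⌢ 2 ⟩ ∷ [])
    ∷ (⟨ 2 - 1 ⌢ 3 ⟩ ∷ ⟨ 2 ⌢ 1 - 3 ⟩ ∷ ⟨ 1 ⌢ 3 - 2 ⟩ ∷ ⟨ 1 - 3 ⌢ 2 ⟩ ∷ [])
    ∷ (⟨ 2 - 3 ⌢ 1 ⟩ ∷ ⟨ 2 ⌢ 3 - 1 ⟩ ∷ ⟨ 1 - 3 ⌢ 2 ⟩ ∷ ⟨ 1 ⌢ 3 - 2 ⟩ ∷ [])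
    ∷ [])
mainTheorem3 =
    (λ { (suc n) _ → inverse
      (S↔Free LastLargest (mono lastLargestRule)
        ((1<3 , 2<3) ∷ (1<3 , 2<3) ∷ (2<3 , 1<3) ∷ (2<3 , 1<3) ∷ [])
        (λ π avoids i<j j<k → avoids-1-23∧2-13 π i<j j<k
          (avoids _ (here refl)) (avoids _ (there (there (here refl))))))
      (cardinality lastLargestRule n) })
  ∷ (λ { (suc n) _ → inverse
      (S↔Free LastMedian (mono lastMedianRule)
        (inj₂ (1<2 , 2<3) ∷ inj₂ (1<2 , 2<3) ∷ inj₁ (1<2 , 2<3) ∷ inj₁ (1<2 , 2<3) ∷ [])
        (λ π avoids i<j j<k →
          [ avoids-13-2 π i<j j<k (avoids _ (there (there (here refl))))
          , avoids-31-2 π i<j j<k (avoids _ (here refl)) ]′))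
      (cardinality lastMedianRule n) })
  ∷ (λ { (suc n) _ → inverse
      (S↔Free 213or132 (mono 213or132Rule)
        (inj₁ (1<2 , 2<3) ∷ inj₁ (1<2 , 2<3) ∷ inj₂ (1<2 , 2<3) ∷ inj₂ (1<2 , 2<3) ∷ [])
        (λ π avoids i<j j<k →
          [ avoids-2-13 π i<j j<k (avoids _ (here refl))
          , avoids-13-2 π i<j j<k (avoids _ (there (there (here refl)))) ]′))
      (cardinality 213or132Rule n) })
  ∷ (λ { (suc n) _ → inverse
      (S↔Free MiddleLargest (λ _ _ _ _ h → map h h)
        ((2<3 , 1<3) ∷ (2<3 , 1<3) ∷ (1<3 , 2<3) ∷ (1<3 , 2<3) ∷ [])
        (λ π avoids {i} {_} {k} i<j j<k (x<y , z<y) →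
          -- The order of the outer letters decides whether the triple is a 132 or a 231.
          case <-cmp (π ⟨$⟩ʳ i) (π ⟨$⟩ʳ k) of λ where
            (tri< x<z _ _) →
              avoids-13-2 π i<j j<k (avoids _ (there (there (there (here refl))))) (x<z , z<y)
            (tri≈ _ x≡z _) → π-distinct π (<-trans i<j j<k) x≡z
            (tri> _ _ z<x) →
              avoids-2-31 π i<j j<k (avoids _ (here refl)) (z<x , x<y)))
      (inverse middleLargest↔lastMedian (cardinality lastMedianRule n)) })
  ∷ []
  where
  open AppendRule using (mono)
  open Counting using (cardinality)
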